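{- Let $G_1=(V,D_1)$ and $G_2=(V,D_2)$ be simple directed graphs on the same node set $V$, neither of which is complete. Suppose they have the same out-degree sequence, meaning $|\mathrm{ch}_1(v)|=|\mathrm{ch}_2(v)|$ for every $v\in V$, and that $D_1\neq D_2$. If one of the graphs is acyclic, then there exist $k\in\{1,2\}$, a node $i\in V$, and a set $L$ that is parentally closed with respect to $i$ in $G_k$ such that $|\mathrm{ch}_k(i)\cap L|>|\mathrm{ch}_{3-k}(i)\cap L|$.
   Context: A directed graph $G=(V,D)$ has edge set $D\subseteq V\times V$ of ordered pairs $(i,j)$, $i\neq j$. It is simple if $(i,j)$ and $(j,i)$ are never both in $D$. It is complete if every pair of distinct nodes is adjacent. $\mathrm{ch}_k(i)$ and $\mathrm{pa}_k(i)$ are the children and parents of $i$ in $G_k$, and $\mathrm{ne}_k(i)$ is the set of nodes adjacent to $i$ in $G_k$. For a set $L$ of nodes, $\mathrm{pa}_k(L)=\bigcup_{l\in L}\mathrm{pa}_k(l)$. A subset $L\subseteq\mathrm{ne}_k(i)$ is parentally closed with respect to $i$ in $G_k$ if $\mathrm{pa}_k(L)\cap\mathrm{ne}_k(i)\subseteq L$. -}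

module Defs where

open import Level using (0ℓ)
open import Data.Nat.Base using (ℕ)
open import Data.Fin.Base using (Fin)
open import Data.Fin.Properties using (any?)
open import Data.Fin.Subset using (Subset; _∩_; _⊆_)
open import Data.Fin.Subset.Properties using (_∈?_)
open import Data.Product.Base using (_×_)
open import Data.Sum.Base using (_⊎_)
open import Data.Vec.Base using (tabulate)
open import Function.Bundles using (_⇔_)
open import Relation.Binary.Construct.Closure.Transitive using (TransClosure)
open import Relation.Binary.Core using (Rel)
import Relation.Binary.Definitions as B
open import Relation.Binary.PropositionalEquality using (_≢_)
open import Relation.Nullary using (¬_; does)
open import Relation.Nullary.Decidable using (_×-dec_; _⊎-dec_)
open import Relation.Unary using (Pred; Decidable)

-- The node set V is Fin n. The edge set D is a decidable relation, so that
-- neighbourhoods are finite sets that can be counted.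
record DiGraph (n : ℕ) : Set₁ where
  infix 4 _⟶_ _⟶?_
  field
    _⟶_   : Rel (Fin n) 0ℓ
    _⟶?_  : B.Decidable _⟶_
    irrefl : ∀ i → ¬ (i ⟶ i)

comprehension : ∀ {n} {P : Pred (Fin n) 0ℓ} → Decidable P → Subset n
comprehension P? = tabulate (λ i → does (P? i))

-- Equality of edge sets, D₁ = D₂, is extensional.
SameEdges : ∀ {n} → DiGraph n → DiGraph n → Set
SameEdges G H = ∀ i j → (DiGraph._⟶_ G i j) ⇔ (DiGraph._⟶_ H i j)

module _ {n : ℕ} (G : DiGraph n) where
  open DiGraph G

  Adjacent : Rel (Fin n) 0ℓ
  Adjacent i j = i ⟶ j ⊎ j ⟶ i

  Simple : Set
  Simple = ∀ i j → ¬ (i ⟶ j × j ⟶ i)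

  Complete : Set
  Complete = ∀ i j → i ≢ j → Adjacent i j

  Acyclic : Set
  Acyclic = ∀ i → ¬ TransClosure _⟶_ i i

  ch : Fin n → Subset n
  ch i = comprehension (λ j → i ⟶? j)

  pa : Fin n → Subset n
  pa i = comprehension (λ j → j ⟶? i)

  ne : Fin n → Subset n
  ne i = comprehension (λ j → (i ⟶? j) ⊎-dec (j ⟶? i))

  paSet : Subset n → Subset n
  paSet L = comprehension (λ j → any? (λ l → (l ∈? L) ×-dec (j ∈? pa l)))

  ParentallyClosed : Fin n → Subset n → Set
  ParentallyClosed i L = L ⊆ ne i × (paSet L ∩ ne i) ⊆ L

{-# OPTIONS --safe #-}
module Submission where

-- If G is acyclic and no L = ne i gives a violation in G, then, the out-degrees
-- being equal, every edge of H joins nodes that are adjacent in G. By induction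
-- along G from its sources, ch i is then the same in both graphs: an edge i ⟶ j
-- of H that is reversed in G would make j a parent of i in G, so by induction
-- also in H, against simplicity. Hence ch i in H is contained in ch i in G, and
-- the two have the same size.

open import Defs
open import Level using (0ℓ)
open import Data.Nat.Base using (ℕ; _>_; _≤_)
open import Data.Nat.Properties using (_<?_; ≮⇒≥; ≤-reflexive; <⇒≱)
open import Data.Fin.Base using (Fin; zero; suc; opposite)
open import Data.Fin.Induction using (spo-wellFounded)
open import Data.Fin.Properties using (any?)
open import Data.Fin.Subset using (Subset; ∣_∣; _∩_; _∈_; _⊆_)
open import Data.Fin.Subset.Properties
  using (_∈?_; ⊆-antisym; p∩q⊆p; p∩q⊆q; x∈p∩q⁺; p⊂q⇒∣p∣<∣q∣)
open import Data.Product.Base using (_×_; ∃; _,_)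
open import Data.Sum.Base using (_⊎_; inj₁; inj₂)
open import Data.Vec.Properties using (lookup∘tabulate; []=⇒lookup; lookup⇒[]=)
open import Function.Base using (_∘_)
open import Function.Bundles using (mk⇔)
open import Function.Properties.Equivalence using () renaming (sym to ⇔-sym)
open import Induction.WellFounded using (WellFounded; Acc; acc)
open import Relation.Binary.Construct.Closure.Transitive
  using (TransClosure; [_]; transitive)
open import Relation.Binary.PropositionalEquality
  using (_≡_; refl; sym; trans; cong; subst; resp₂; isEquivalence)
open import Relation.Binary.Structures using (IsStrictPartialOrder)
open import Relation.Nullary using (¬_; yes; no; does; proof; Reflects; invert; contradiction)
open import Relation.Nullary.Decidable using (dec-true; _⊎-dec_; decidable-stable)
open import Relation.Unary using (Pred; Decidable)

module _ {n : ℕ} {P : Pred (Fin n) 0ℓ} (P? : Decidable P) where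

  ∈-comprehension⁺ : ∀ {i} → P i → i ∈ comprehension P?
  ∈-comprehension⁺ {i} p =
    lookup⇒[]= i _ (trans (lookup∘tabulate (does ∘ P?) i) (dec-true (P? i) p))

  ∈-comprehension⁻ : ∀ {i} → i ∈ comprehension P? → P i
  ∈-comprehension⁻ {i} i∈ = invert (subst (Reflects (P i))
    (trans (sym (lookup∘tabulate (does ∘ P?) i)) ([]=⇒lookup i∈)) (proof (P? i)))

-- An element of `q` outside `p` would make the inclusion strict, hence `p` strictly smaller than
-- `q`.
p⊆q∧∣q∣≤∣p∣⇒q⊆p : ∀ {n} {p q : Subset n} → p ⊆ q → ∣ q ∣ ≤ ∣ p ∣ → q ⊆ p
p⊆q∧∣q∣≤∣p∣⇒q⊆p {p = p} p⊆q ∣q∣≤∣p∣ {x} x∈q = decidable-stable (x ∈? p) λ x∉p →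
  <⇒≱ (p⊂q⇒∣p∣<∣q∣ (p⊆q , x , x∈q , x∉p)) ∣q∣≤∣p∣

module _ {n : ℕ} (G : DiGraph n) where
  open DiGraph G

  -- Acyclicity is irreflexivity of the transitive closure, which is therefore a strict partial
  -- order; on a finite set such an order is well-founded.
  acyclic⇒wellFounded : Acyclic G → WellFounded (TransClosure _⟶_)
  acyclic⇒wellFounded acyclic = spo-wellFounded isStrictPartialOrder
    where
    isStrictPartialOrder : IsStrictPartialOrder _≡_ (TransClosure _⟶_)
    isStrictPartialOrder = record
      { isEquivalence = isEquivalence
      ; irrefl        = λ { refl → acyclic _ }
      ; trans         = transitive _⟶_
      ; <-resp-≈      = resp₂ _
      }

  ∈-ch⁺ : ∀ {i j} → i ⟶ j → j ∈ ch G i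
  ∈-ch⁺ {i} = ∈-comprehension⁺ (i ⟶?_)

  ∈-ch⁻ : ∀ {i j} → j ∈ ch G i → i ⟶ j
  ∈-ch⁻ {i} = ∈-comprehension⁻ (i ⟶?_)

  ∈-ne⁺ : ∀ {i j} → Adjacent G i j → j ∈ ne G i
  ∈-ne⁺ {i} = ∈-comprehension⁺ (λ j → (i ⟶? j) ⊎-dec (j ⟶? i))

  ∈-ne⁻ : ∀ {i j} → j ∈ ne G i → Adjacent G i j
  ∈-ne⁻ {i} = ∈-comprehension⁻ (λ j → (i ⟶? j) ⊎-dec (j ⟶? i))

  ch⊆ne : ∀ i → ch G i ⊆ ne G i
  ch⊆ne i = ∈-ne⁺ ∘ inj₁ ∘ ∈-ch⁻

  ne-parentallyClosed : ∀ i → ParentallyClosed G i (ne G i)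
  ne-parentallyClosed i = (λ j∈ne → j∈ne) , p∩q⊆q _ _

module _ {n : ℕ} (G H : DiGraph n)
         (∣ch∣≡ : ∀ i → ∣ ch G i ∣ ≡ ∣ ch H i ∣) where
  private
    module G = DiGraph G
    module H = DiGraph H

  -- Since `ch G i` lies within `ne G i`, the left side is the common out-degree of `i`. So
  -- `ch H i ∩ ne G i` is at least as large as `ch H i`, and must be all of it.
  ch⊆ne-other : ∀ i → ∣ ch G i ∩ ne G i ∣ ≤ ∣ ch H i ∩ ne G i ∣ → ch H i ⊆ ne G i
  ch⊆ne-other i ≤∩ =
    p∩q⊆q _ _ ∘ p⊆q∧∣q∣≤∣p∣⇒q⊆p (p∩q⊆p _ _) (subst (_≤ ∣ ch H i ∩ ne G i ∣) ∣ch∩ne∣≡ ≤∩)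
    where
    ∣ch∩ne∣≡ : ∣ ch G i ∩ ne G i ∣ ≡ ∣ ch H i ∣
    ∣ch∩ne∣≡ = trans
      (cong ∣_∣ (⊆-antisym (p∩q⊆p _ _) λ j∈ch → x∈p∩q⁺ (j∈ch , ch⊆ne G i j∈ch)))
      (∣ch∣≡ i)

  acyclic⇒ch≡ : Acyclic G → Simple H → (∀ i → ch H i ⊆ ne G i) →
                ∀ i → ch G i ≡ ch H i
  acyclic⇒ch≡ acyclic simple ch⊆ne′ i = go i (acyclic⇒wellFounded G acyclic i)
    where
    go : ∀ i → Acc (TransClosure G._⟶_) i → ch G i ≡ ch H i
    go i (acc rec) =
      ⊆-antisym (p⊆q∧∣q∣≤∣p∣⇒q⊆p chH⊆chG (≤-reflexive (∣ch∣≡ i))) chH⊆chG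
      where
      chH⊆chG : ch H i ⊆ ch G i
      chH⊆chG {j} j∈ with ∈-ne⁻ G (ch⊆ne′ i j∈)
      ... | inj₁ i⟶j = ∈-ch⁺ G i⟶j
      ... | inj₂ j⟶i = contradiction (∈-ch⁻ H j∈ , j⟶ᴴi) (simple i j)
        where
        j⟶ᴴi : j H.⟶ i
        -- The parent `j` lies below `i` in the closure order, as a path of length one, so the
        -- induction hypothesis carries its edge to `i` over to `H`.
        j⟶ᴴi = ∈-ch⁻ H (subst (i ∈_) (go j (rec [ j⟶i ])) (∈-ch⁺ G j⟶i))

  ch≡⇒sameEdges : (∀ i → ch G i ≡ ch H i) → SameEdges G H
  ch≡⇒sameEdges ch≡ i j = mk⇔
    (∈-ch⁻ H ∘ subst (j ∈_) (ch≡ i) ∘ ∈-ch⁺ G)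
    (∈-ch⁻ G ∘ subst (j ∈_) (sym (ch≡ i)) ∘ ∈-ch⁺ H)

  acyclic⇒violation : Acyclic G → Simple H → ¬ SameEdges G H →
    ∃ λ i → ∃ λ L → ParentallyClosed G i L × ∣ ch G i ∩ L ∣ > ∣ ch H i ∩ L ∣
  acyclic⇒violation acyclic simple ≢
    -- A violation with `L = ne G i` is sought by finite search, which yields an actual witness; if
    -- the search fails, the reverse inequality holds at every node and forces equal edge sets.
    with any? (λ i → ∣ ch H i ∩ ne G i ∣ <? ∣ ch G i ∩ ne G i ∣)
  ... | yes (i , lt) = i , ne G i , ne-parentallyClosed G i , lt
  ... | no ∄ = contradiction
    (ch≡⇒sameEdges (acyclic⇒ch≡ acyclic simple λ i →
      ch⊆ne-other i (≮⇒≥ λ lt → ∄ (i , lt)))) ≢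

theorem4p13 : ∀ (n : ℕ) (G : Fin 2 → DiGraph n) →
    (∀ k → Simple (G k)) →
    (∀ k → ¬ Complete (G k)) →
    (∀ v → ∣ ch (G zero) v ∣ ≡ ∣ ch (G (suc zero)) v ∣) →
    ¬ SameEdges (G zero) (G (suc zero)) →
    (Acyclic (G zero) ⊎ Acyclic (G (suc zero))) →
    ∃ λ (k : Fin 2) → ∃ λ (i : Fin n) → ∃ λ (L : Subset n) →
    ParentallyClosed (G k) i L ×
    ∣ ch (G k) i ∩ L ∣ > ∣ ch (G (opposite k)) i ∩ L ∣
-- The index `k` is that of the acyclic graph. On `Fin 2`, `opposite` computes to the swap of the
-- two indices.
theorem4p13 n G simple _ ∣ch∣≡ ≢ (inj₁ acyclic) =
  zero , acyclic⇒violation (G zero) (G (suc zero)) ∣ch∣≡ acyclic (simple _) ≢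
theorem4p13 n G simple _ ∣ch∣≡ ≢ (inj₂ acyclic) =
  suc zero , acyclic⇒violation (G (suc zero)) (G zero) (sym ∘ ∣ch∣≡) acyclic (simple _)
    (λ same → ≢ λ i j → ⇔-sym (same i j))
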